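{- Let $D_0=(V,A)$ be a directed graph (parallel arcs allowed), let $k\ge 2$ be an integer, and let $F\subseteq A$ be such that the digraph obtained from $D_0$ by reversing the arcs of $F$ is $k$-arc-connected. Then there exist reorientations $D_1,\dots,D_\ell$ of $D_0$ such that for all $0\le i\le \ell-1$, $D_{i+1}$ is obtained from $D_i$ by reversing one arc of $F$, and $\lambda(D_0)\le\lambda(D_1)\le\dots\le\lambda(D_\ell)$ and $\lambda(D_\ell)\ge\lfloor\frac{k+3}{2}\rfloor$.
   Context: For a digraph $D=(V,A)$ and $X\subseteq V$, $d^-_A(X)$ denotes the number of arcs $uv\in A$ with $u\notin X$, $v\in X$. The arc-connectivity of $D$ is $\lambda(D)=\min\{d^-_A(X):\emptyset\ne X\subsetneq V\}$; $D$ is $k$-arc-connected if $\lambda(D)\ge k$. Reversing an arc $uv$ means replacing it by $vu$. A reorientation of $D$ is a digraph obtained from $D$ by reversing some of its arcs. -}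

module Defs where

open import Data.Nat using (ℕ; zero; suc; _≤_; _+_; _⊓_)
open import Data.Bool using (Bool; true; false; if_then_else_; _∧_; not; _xor_)
open import Data.Fin using (Fin; _≟_)
import Data.Fin as Fin
open import Data.Fin.Subset using (Subset; ⁅_⁆)
open import Data.Vec using (Vec; []; _∷_; lookup)
open import Data.List using (List; []; _∷_; map; _++_; filter; foldr; length)
open import Data.Maybe using (Maybe; just; nothing)
open import Data.Product using (_×_; _,_; proj₁; proj₂)
open import Data.Unit using (⊤)
open import Data.Empty using (⊥)
open import Relation.Nullary using (Dec; yes; no; ¬_)
open import Relation.Nullary.Decidable using (⌊_⌋)
open import Data.List.Relation.Unary.All using (All)

-- A digraph (parallel arcs and loops allowed) on vertex set Fin n with
-- arc set Fin m; arc a goes from (tail a) to (head a).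
record Digraph (n m : ℕ) : Set where
  field
    tail : Fin m → Fin n
    head : Fin m → Fin n
open Digraph public

reverseArcs : ∀ {n m} → Digraph n m → (Fin m → Bool) → Digraph n m
tail (reverseArcs D R) a = if R a then head D a else tail D a
head (reverseArcs D R) a = if R a then tail D a else head D a

-- D' is a reorientation of D: obtained by reversing some set of arcs.
-- Since arcs are indexed, reorientations of D are exactly reverseArcs D R.

allFinList : (m : ℕ) → List (Fin m)
allFinList zero = []
allFinList (suc m) = Fin.zero ∷ map Fin.suc (allFinList m)

allSubsets : (n : ℕ) → List (Subset n)
allSubsets zero = [] ∷ []
allSubsets (suc n) = map (true ∷_) (allSubsets n) ++ map (false ∷_) (allSubsets n)

count : ∀ {A : Set} → (A → Bool) → List A → ℕ
count p [] = 0
count p (x ∷ xs) = (if p x then 1 else 0) + count p xs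

inDeg : ∀ {n m} → Digraph n m → Subset n → ℕ
inDeg {n} {m} D X =
  count (λ a → not (lookup X (tail D a)) ∧ lookup X (head D a)) (allFinList m)

isNonemptyProper : ∀ {n} → Subset n → Bool
isNonemptyProper {n} X =
  not (count (λ v → lookup X v) (allFinList n) ≡ᵇ 0)
  ∧ not (count (λ v → lookup X v) (allFinList n) ≡ᵇ n)
  where open import Data.Nat using (_≡ᵇ_)

-- ℕ extended with ∞ (nothing = ∞), the value of a minimum over the empty set.
ℕ∞ : Set
ℕ∞ = Maybe ℕ

min∞ : ℕ∞ → ℕ∞ → ℕ∞
min∞ nothing y = y
min∞ (just x) nothing = just x
min∞ (just x) (just y) = just (x ⊓ y)

_≤∞_ : ℕ∞ → ℕ∞ → Set
_ ≤∞ nothing = ⊤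
nothing ≤∞ just _ = ⊥
just x ≤∞ just y = x ≤ y

-- λ(D) = min { d⁻(X) : ∅ ≠ X ⊊ V }  (∞ if |V| ≤ 1).
arcConn : ∀ {n m} → Digraph n m → ℕ∞
arcConn {n} D =
  foldr (λ X r → if isNonemptyProper X then min∞ (just (inDeg D X)) r else r)
        nothing (allSubsets n)

_IsArcConnected_ : ∀ {n m} → Digraph n m → ℕ → Set
D IsArcConnected k = just k ≤∞ arcConn D

reverseArc : ∀ {n m} → Digraph n m → Fin m → Digraph n m
reverseArc D a = reverseArcs D (λ b → ⌊ b ≟ a ⌋)

flipSeq : ∀ {n m} → Digraph n m → List (Fin m) → List (Digraph n m)
flipSeq D [] = D ∷ []
flipSeq D (a ∷ as) = D ∷ flipSeq (reverseArc D a) as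

lastDigraph : ∀ {n m} → Digraph n m → List (Fin m) → Digraph n m
lastDigraph D [] = D
lastDigraph D (a ∷ as) = lastDigraph (reverseArc D a) as

data ArcConnMonotone {n m : ℕ} : List (Digraph n m) → Set where
  []  : ArcConnMonotone []
  [_] : ∀ D → ArcConnMonotone (D ∷ [])
  _∷_ : ∀ {D D' Ds} → arcConn D ≤∞ arcConn D' →
        ArcConnMonotone (D' ∷ Ds) → ArcConnMonotone (D ∷ D' ∷ Ds)

{-# OPTIONS --safe #-}
module Submission where

-- It suffices to find, whenever ℓ = λ(D) satisfies 2ℓ ≤ k + 1 and ℓ < k, an arc of F that can be
-- reversed without decreasing λ, i.e. one entering no tight set (d⁻(X) = ℓ).  Suppose every arc of F
-- enters a tight set.  A tight X has d_F⁺(X) - d_F⁻(X) ≥ k - ℓ > 0, and this excess is additive over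
-- disjoint unions.  By uncrossing, an arc of F leaving a tight Z enters a tight W that is disjoint
-- from Z or satisfies Z ∪ W = V.  In the latter case the out-tight set V ∖ W is nested in Z and the
-- arc leaves both; `nest-free` excludes this by induction on the outer set, and this is where
-- 2ℓ ≤ k + 1 enters.  In the former case W can be merged into any disjoint family of tight sets
-- containing Z, so a union of disjoint tight sets can be enlarged forever, which is absurd.

open import Defs
open import Data.Nat using (ℕ; zero; suc; _≤_; _<_; _+_; _*_; _/_; z≤n; s≤s; _≤ᵇ_; _≡ᵇ_)
open import Data.Nat.DivMod using (m/n*n≤m)
open import Data.Nat.Properties
open import Data.Nat.Tactic.RingSolver using (solve-∀)
open import Data.Bool using (Bool; true; false; not; _∧_; _∨_; if_then_else_)
import Data.Bool as Bool
open import Data.Bool.Properties using (¬-not; T-≡; not-injective; if-float)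
open import Data.Fin using (Fin; zero; suc)
import Data.Fin as Fin
open import Data.Fin.Subset using (Subset)
open import Data.Fin.Properties using (any?)
open import Data.List using (List; []; _∷_; map; length; foldr)
open import Data.List.Membership.Propositional using (_∈_)
open import Data.List.Membership.Propositional.Properties using (∈-map⁺; ∈-++⁺ˡ; ∈-++⁺ʳ)
open import Data.List.Relation.Unary.All as All using (All; []; _∷_)
open import Data.List.Relation.Unary.AllPairs using (AllPairs; []; _∷_)
open import Data.List.Relation.Unary.Any using (here; there)
open import Data.Vec using (Vec; []; _∷_; lookup; tabulate)
open import Data.Vec.Properties using (lookup∘tabulate)
open import Data.Maybe using (just; nothing)
open import Data.Product using (Σ; ∃-syntax; _×_; _,_; proj₁; proj₂)
open import Data.Sum using (_⊎_; inj₁; inj₂)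
open import Data.Empty using (⊥; ⊥-elim)
open import Function using (_∘_; Equivalence)
open import Relation.Nullary using (Dec; yes; no; ¬_)
open import Relation.Nullary.Decidable using (_×-dec_; ⌊_⌋; isYes≗does)
open import Relation.Binary.PropositionalEquality

-- Counting by truth tables

total : List ℕ → ℕ
total []           = 0
-- The singleton clause keeps a trailing `+ 0` out of the inequalities produced by `count-≤`.
total (x ∷ [])     = x
total (x ∷ y ∷ xs) = x + total (y ∷ xs)

total-∷ : ∀ x xs → total (x ∷ xs) ≡ x + total xs
total-∷ x []       = sym (+-identityʳ x)
total-∷ x (y ∷ xs) = refl

# : ∀ {m} → (Fin m → Bool) → ℕ
# {m} p = count p (allFinList m)

indicator : Bool → ℕ
indicator b = if b then 1 else 0

module _ {A : Set} where

  counts : List A → List (A → Bool) → ℕ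
  counts xs ps = total (map (λ p → count p xs) ps)

  weight : List (A → Bool) → A → ℕ
  weight ps x = total (map (λ p → indicator (p x)) ps)

  counts-[] : ∀ ps → counts [] ps ≡ 0
  counts-[] []       = refl
  counts-[] (p ∷ ps) = trans (total-∷ 0 (map (λ p → count p []) ps)) (counts-[] ps)

  counts-∷ : ∀ x xs ps → counts (x ∷ xs) ps ≡ weight ps x + counts xs ps
  counts-∷ x xs []       = refl
  counts-∷ x xs (p ∷ ps) = begin
    counts (x ∷ xs) (p ∷ ps)
      ≡⟨ total-∷ _ (map (λ q → count q (x ∷ xs)) ps) ⟩
    indicator (p x) + count p xs + counts (x ∷ xs) ps
      ≡⟨ cong (indicator (p x) + count p xs +_) (counts-∷ x xs ps) ⟩
    indicator (p x) + count p xs + (weight ps x + counts xs ps)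
      ≡⟨ interchange (indicator (p x)) (count p xs) (weight ps x) (counts xs ps) ⟩
    indicator (p x) + weight ps x + (count p xs + counts xs ps)
      ≡⟨ sym (cong₂ _+_ (total-∷ _ (map (λ q → indicator (q x)) ps)) (total-∷ _ (map (λ q → count q xs) ps))) ⟩
    weight (p ∷ ps) x + counts xs (p ∷ ps) ∎
    where
    open ≡-Reasoning
    interchange : ∀ a b c d → a + b + (c + d) ≡ a + c + (b + d)
    interchange = solve-∀

  counts-mono : ∀ xs ps qs → (∀ x → weight ps x ≤ weight qs x) → counts xs ps ≤ counts xs qs
  counts-mono []       ps qs le = ≤-reflexive (trans (counts-[] ps) (sym (counts-[] qs)))
  counts-mono (x ∷ xs) ps qs le
    rewrite counts-∷ x xs ps | counts-∷ x xs qs = +-mono-≤ (le x) (counts-mono xs ps qs le)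

-- Computes to `true` on a concrete valid `P`, so the truth tables required by `count-≤` are checked
-- by `refl`.
tautology : ∀ j → (Vec Bool j → Bool) → Bool
tautology zero    P = P []
tautology (suc j) P = tautology j (P ∘ (true ∷_)) ∧ tautology j (P ∘ (false ∷_))

∧-true : ∀ {b c} → b ≡ true → c ≡ true → b ∧ c ≡ true
∧-true refl refl = refl

∧-trueˡ : ∀ {b c} → b ∧ c ≡ true → b ≡ true
∧-trueˡ {true} _ = refl

∧-trueʳ : ∀ {b c} → b ∧ c ≡ true → c ≡ true
∧-trueʳ {true} eq = eq

∨-true : ∀ {b c} → b ∨ c ≡ true → b ≡ true ⊎ c ≡ true
∨-true {true}  _  = inj₁ refl
∨-true {false} eq = inj₂ eq

∨-trueˡ : ∀ {b c} → b ≡ true → b ∨ c ≡ true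
∨-trueˡ refl = refl

∨-trueʳ : ∀ b {c} → c ≡ true → b ∨ c ≡ true
∨-trueʳ true  _  = refl
∨-trueʳ false eq = eq

∨-false : ∀ {b c} → b ≡ false → c ≡ false → b ∨ c ≡ false
∨-false refl refl = refl

true≢false : ∀ {b} → b ≡ true → b ≡ false → ⊥
true≢false refl ()

implies : ∀ {b c} → (b ≡ true → c ≡ true) → not b ∨ c ≡ true
implies {true}  f = f refl
implies {false} f = refl

excludes : ∀ {b c} → (b ≡ true → c ≡ true → ⊥) → not (b ∧ c) ≡ true
excludes {true}  {true}  f = ⊥-elim (f refl refl)
excludes {true}  {false} f = refl
excludes {false}         f = refl

tautology-sound : ∀ j {P} → tautology j P ≡ true → ∀ v → P v ≡ true
tautology-sound zero    h []          = h
tautology-sound (suc j) h (true ∷ v)  = tautology-sound j (∧-trueˡ h) v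
tautology-sound (suc j) {P} h (false ∷ v) =
  tautology-sound j (∧-trueʳ {tautology j (P ∘ (true ∷_))} h) v

-- Linear inequalities between cardinalities of arc (or vertex) sets hold as soon as they hold
-- pointwise for the indicators, which is a truth table in finitely many bits per element.
count-≤ : ∀ {j m} (bits : Fin m → Vec Bool j) (hyp : Vec Bool j → Bool)
  (ps qs : List (Vec Bool j → Bool)) →
  tautology j (λ v → not (hyp v) ∨ (weight ps v ≤ᵇ weight qs v)) ≡ true →
  (∀ a → hyp (bits a) ≡ true) →
  total (map (λ p → # (p ∘ bits)) ps) ≤ total (map (λ q → # (q ∘ bits)) qs)
count-≤ {j} {m} bits hyp ps qs taut h =
  subst₂ _≤_ (counts-∘ ps) (counts-∘ qs)
    (counts-mono (allFinList m) (map (_∘ bits) ps) (map (_∘ bits) qs) pointwise)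
  where
  counts-∘ : ∀ rs → counts (allFinList m) (map (_∘ bits) rs) ≡ total (map (λ r → # (r ∘ bits)) rs)
  counts-∘ []           = refl
  counts-∘ (_ ∷ [])     = refl
  counts-∘ (r ∷ s ∷ rs) = cong (# (r ∘ bits) +_) (counts-∘ (s ∷ rs))
  weight-∘ : ∀ rs a → weight (map (_∘ bits) rs) a ≡ weight rs (bits a)
  weight-∘ []           a = refl
  weight-∘ (_ ∷ [])     a = refl
  weight-∘ (r ∷ s ∷ rs) a = cong (indicator (r (bits a)) +_) (weight-∘ (s ∷ rs) a)
  pointwise : ∀ a → weight (map (_∘ bits) ps) a ≤ weight (map (_∘ bits) qs) a
  pointwise a rewrite weight-∘ ps a | weight-∘ qs a
    with hyp (bits a) | h a | tautology-sound j taut (bits a)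
  ... | true | _ | le = ≤ᵇ⇒≤ _ _ (Equivalence.from T-≡ le)

count-map : ∀ {A B : Set} (f : A → B) p xs → count p (map f xs) ≡ count (p ∘ f) xs
count-map f p []       = refl
count-map f p (x ∷ xs) = cong (indicator (p (f x)) +_) (count-map f p xs)

#-pos : ∀ {m} (p : Fin m → Bool) a → p a ≡ true → 1 ≤ # p
#-pos p zero    eq rewrite eq = s≤s z≤n
#-pos {suc m} p (suc a) eq rewrite count-map suc p (allFinList m) =
  ≤-trans (#-pos (p ∘ suc) a eq) (m≤n+m _ (indicator (p zero)))

#-all : ∀ m → # {m} (λ _ → true) ≡ m
#-all zero    = refl
#-all (suc m) = cong suc (trans (count-map suc (λ _ → true) (allFinList m)) (#-all m))

-- Vertex sets as Boolean predicates

VSet : ℕ → Set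
VSet n = Fin n → Bool

module _ {n : ℕ} where

  infixr 6 _∪_
  infixr 7 _∩_
  infix  4 _⊆_

  _∪_ _∩_ : VSet n → VSet n → VSet n
  (X ∪ Y) v = X v ∨ Y v
  (X ∩ Y) v = X v ∧ Y v

  ∁ : VSet n → VSet n
  ∁ X v = not (X v)

  ⋃ : List (VSet n) → VSet n
  ⋃ = foldr _∪_ (λ _ → false)

  _⊆_ : VSet n → VSet n → Set
  X ⊆ Y = ∀ {v} → X v ≡ true → Y v ≡ true

  Disjoint Meet : VSet n → VSet n → Set
  Disjoint X Y = ∀ {v} → X v ≡ true → Y v ≡ true → ⊥
  Meet X Y = ∃[ v ] X v ≡ true × Y v ≡ true

  Proper : VSet n → Set
  Proper X = (∃[ v ] X v ≡ true) × (∃[ w ] X w ≡ false)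

  meet? : ∀ X Y → Dec (Meet X Y)
  meet? X Y = any? λ v → (X v Bool.≟ true) ×-dec (Y v Bool.≟ true)

  ∁-proper : ∀ {X} → Proper X → Proper (∁ X)
  ∁-proper ((v , Xv) , (w , Xw)) = (w , cong not Xw) , (v , cong not Xv)

  ⊆-or-escape : ∀ X Y → X ⊆ Y ⊎ ∃[ v ] X v ≡ true × Y v ≡ false
  ⊆-or-escape X Y with any? (λ v → (X v Bool.≟ true) ×-dec (Y v Bool.≟ false))
  ... | yes e = inj₂ e
  ... | no ¬e = inj₁ λ {v} Xv → ¬-not λ Yv → ¬e (v , Xv , Yv)

  #-⊂ : ∀ {X Y u} → X ⊆ Y → X u ≡ false → Y u ≡ true → # X < # Y
  #-⊂ {X} {Y} {u} X⊆Y Xu Yu = begin-strict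
    # X                       <⟨ m<m+n (# X) (#-pos _ u (∧-true Yu (cong not Xu))) ⟩
    # X + # (λ v → Y v ∧ not (X v))
      ≤⟨ count-≤ (λ v → X v ∷ Y v ∷ []) (λ { (x ∷ y ∷ []) → not x ∨ y })
           ((λ { (x ∷ y ∷ []) → x }) ∷ (λ { (x ∷ y ∷ []) → y ∧ not x }) ∷ [])
           ((λ { (x ∷ y ∷ []) → y }) ∷ []) refl (λ _ → implies X⊆Y) ⟩
    # Y ∎
    where open ≤-Reasoning

  #≤n : ∀ X → # X ≤ n
  #≤n X = subst (# X ≤_) (#-all n)
    (count-≤ {m = n} (λ v → X v ∷ []) (λ _ → true) ((λ { (x ∷ []) → x }) ∷ []) ((λ _ → true) ∷ [])
      refl (λ _ → refl))

  ∈-⋃ : ∀ {Xs X v} → X ∈ Xs → X v ≡ true → ⋃ Xs v ≡ true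
  ∈-⋃ (here refl)      Xv = ∨-trueˡ Xv
  ∈-⋃ {Y ∷ _} {v = v} (there X∈) Xv = ∨-trueʳ (Y v) (∈-⋃ X∈ Xv)

  ⋃-∈ : ∀ Xs {v} → ⋃ Xs v ≡ true → ∃[ X ] X ∈ Xs × X v ≡ true
  ⋃-∈ (Y ∷ Xs) h with ∨-true h
  ... | inj₁ Yv = Y , here refl , Yv
  ... | inj₂ h′ with ⋃-∈ Xs h′
  ... | X , X∈ , Xv = X , there X∈ , Xv

  same-block : ∀ {Xs X Y v} → AllPairs Disjoint Xs → X ∈ Xs → Y ∈ Xs →
    X v ≡ true → Y v ≡ true → X ≡ Y
  same-block (ds ∷ _) (here refl) (here refl) _  _  = refl
  same-block (ds ∷ _) (here refl) (there Y∈)  Xv Yv = ⊥-elim (All.lookup ds Y∈ Xv Yv)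
  same-block (ds ∷ _) (there X∈)  (here refl) Xv Yv = ⊥-elim (All.lookup ds X∈ Yv Xv)
  same-block (_ ∷ ds) (there X∈)  (there Y∈)  Xv Yv = same-block ds X∈ Y∈ Xv Yv

  Refines : List (VSet n) → List (VSet n) → Set
  Refines Xs Ys = ∀ {X} → X ∈ Xs → ∃[ Y ] Y ∈ Ys × X ⊆ Y

-- Stuck digraphs and their reversal symmetry

rev : ∀ {n m} → Digraph n m → Digraph n m
rev G = record { tail = head G ; head = tail G }

inDegree : ∀ {n m} → Digraph n m → VSet n → ℕ
inDegree G X = # λ a → not (X (tail G a)) ∧ X (head G a)

module _ {n m : ℕ} (F : Fin m → Bool) (k ℓ : ℕ) (ℓ<k : ℓ < k) (2ℓ≤1+k : ℓ + ℓ ≤ suc k) where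

  inDegreeF : Digraph n m → VSet n → ℕ
  inDegreeF G X = # λ a → F a ∧ (not (X (tail G a)) ∧ X (head G a))

  -- In a stuck digraph the bound is an equality. Sets with `Tight (rev G)`, which at most `ℓ` arcs
  -- leave, are the out-tight ones.
  Tight : Digraph n m → VSet n → Set
  Tight G X = Proper X × inDegree G X ≤ ℓ

  -- `gain` is k-arc-connectivity after reversing F, written without subtraction.
  record Stuck (G : Digraph n m) : Set where
    field
      connected : ∀ {X} → Proper X → ℓ ≤ inDegree G X
      gain      : ∀ {X} → Proper X → k + inDegreeF G X ≤ inDegree G X + inDegreeF (rev G) X
      covered   : ∀ a → F a ≡ true →
                  ∃[ X ] Tight G X × X (tail G a) ≡ false × X (head G a) ≡ true
  open Stuck

  inDegree-∁ : ∀ (G : Digraph n m) X → inDegree (rev G) (∁ X) ≤ inDegree G X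
  inDegree-∁ G X = count-≤ {m = m} (λ a → X (tail G a) ∷ X (head G a) ∷ []) (λ _ → true)
    ((λ { (t ∷ h ∷ []) → not (not h) ∧ not t }) ∷ [])
    ((λ { (t ∷ h ∷ []) → not t ∧ h }) ∷ []) refl (λ _ → refl)

  inDegreeF-∁ : ∀ (G : Digraph n m) X → inDegreeF (rev G) (∁ X) ≤ inDegreeF G X
  inDegreeF-∁ G X = count-≤ {m = m} (λ a → F a ∷ X (tail G a) ∷ X (head G a) ∷ []) (λ _ → true)
    ((λ { (f ∷ t ∷ h ∷ []) → f ∧ (not (not h) ∧ not t) }) ∷ [])
    ((λ { (f ∷ t ∷ h ∷ []) → f ∧ (not t ∧ h) }) ∷ []) refl (λ _ → refl)

  ∁-inDegreeF : ∀ (G : Digraph n m) X → inDegreeF G X ≤ inDegreeF (rev G) (∁ X)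
  ∁-inDegreeF G X = count-≤ {m = m} (λ a → F a ∷ X (tail G a) ∷ X (head G a) ∷ []) (λ _ → true)
    ((λ { (f ∷ t ∷ h ∷ []) → f ∧ (not t ∧ h) }) ∷ [])
    ((λ { (f ∷ t ∷ h ∷ []) → f ∧ (not (not h) ∧ not t) }) ∷ []) refl (λ _ → refl)

  ∁-tight : ∀ {G X} → Tight G X → Tight (rev G) (∁ X)
  ∁-tight {G} {X} (proper , le) = ∁-proper proper , ≤-trans (inDegree-∁ G X) le

  -- Arcs leaving a set enter its complement, so `∁` exchanges tight and out-tight sets and every
  -- fact about stuck digraphs has a dual. As `rev (rev G)` is `G` definitionally, dualising twice
  -- needs no transport.
  stuck-rev : ∀ {G} → Stuck G → Stuck (rev G)
  stuck-rev {G} S = record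
    { connected = λ {X} proper → ≤-trans (connected S (∁-proper proper)) (inDegree-∁ (rev G) X)
    ; gain = λ {X} proper → begin
        k + inDegreeF (rev G) X              ≤⟨ +-monoʳ-≤ k (∁-inDegreeF (rev G) X) ⟩
        k + inDegreeF G (∁ X)                ≤⟨ gain S (∁-proper proper) ⟩
        inDegree G (∁ X) + inDegreeF (rev G) (∁ X)
          ≤⟨ +-mono-≤ (inDegree-∁ (rev G) X) (inDegreeF-∁ G X) ⟩
        inDegree (rev G) X + inDegreeF G X   ∎
    ; covered = λ a Fa → case (covered S a Fa)
    }
    where
    open ≤-Reasoning
    case : ∀ {a} → (∃[ X ] Tight G X × X (tail G a) ≡ false × X (head G a) ≡ true) →
      ∃[ X ] Tight (rev G) X × X (head G a) ≡ false × X (tail G a) ≡ true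
    case (X , X-tight , Xt , Xh) = ∁ X , ∁-tight X-tight , cong not Xh , cong not Xt

  -- Uncrossing and disjoint families of tight sets

  crossing : VSet n → VSet n → Digraph n m → Fin m → Bool
  crossing X Y G a = X (tail G a) ∧ not (Y (tail G a)) ∧ not (X (head G a)) ∧ Y (head G a)

  -- The usual submodularity, sharpened by the arcs from X ∖ Y to Y ∖ X: these enter `Y` but neither
  -- the intersection nor the union.
  submodular : ∀ (G : Digraph n m) X Y →
    inDegree G (X ∩ Y) + (inDegree G (X ∪ Y) + # (crossing X Y G)) ≤ inDegree G X + inDegree G Y
  submodular G X Y = count-≤ {m = m}
    (λ a → X (tail G a) ∷ Y (tail G a) ∷ X (head G a) ∷ Y (head G a) ∷ []) (λ _ → true)
    ((λ { (x ∷ y ∷ x′ ∷ y′ ∷ []) → not (x ∧ y) ∧ (x′ ∧ y′) })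
      ∷ (λ { (x ∷ y ∷ x′ ∷ y′ ∷ []) → not (x ∨ y) ∧ (x′ ∨ y′) })
      ∷ (λ { (x ∷ y ∷ x′ ∷ y′ ∷ []) → x ∧ not y ∧ not x′ ∧ y′ }) ∷ [])
    ((λ { (x ∷ y ∷ x′ ∷ y′ ∷ []) → not x ∧ x′ })
      ∷ (λ { (x ∷ y ∷ x′ ∷ y′ ∷ []) → not y ∧ y′ }) ∷ [])
    refl (λ _ → refl)

  -- With `meet` and `w` both the intersection and the union are proper, so each has in-degree at
  -- least `ℓ` and submodularity leaves no slack.
  module Uncrossing {G X Y} (S : Stuck G) (X-tight : Tight G X) (Y-tight : Tight G Y)
    (meet : Meet X Y) {w : Fin n} (w∉X : X w ≡ false) (w∉Y : Y w ≡ false) where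

    private
      ∩-proper : Proper (X ∩ Y)
      ∩-proper = (proj₁ meet , ∧-true (proj₁ (proj₂ meet)) (proj₂ (proj₂ meet)))
               , (w , cong (_∧ Y w) w∉X)
      ∪-proper : Proper (X ∪ Y)
      ∪-proper = (proj₁ meet , ∨-trueˡ (proj₁ (proj₂ meet))) , (w , ∨-false w∉X w∉Y)

      bound : inDegree G (X ∩ Y) + (inDegree G (X ∪ Y) + # (crossing X Y G)) ≤ ℓ + ℓ
      bound = ≤-trans (submodular G X Y) (+-mono-≤ (proj₂ X-tight) (proj₂ Y-tight))

      rest : inDegree G (X ∪ Y) + # (crossing X Y G) ≤ ℓ
      rest = +-cancelˡ-≤ ℓ _ _ (≤-trans (+-monoˡ-≤ _ (connected S ∩-proper)) bound)

    ∪-tight : Tight G (X ∪ Y)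
    ∪-tight = ∪-proper , ≤-trans (m≤m+n _ _) rest

    ∩-tight : Tight G (X ∩ Y)
    ∩-tight = ∩-proper , +-cancelʳ-≤ ℓ _ _
      (≤-trans (+-monoʳ-≤ _ (≤-trans (connected S ∪-proper) (m≤m+n _ (# (crossing X Y G))))) bound)

    no-crossing-arc : ∀ a → X (tail G a) ≡ true → X (head G a) ≡ false →
      Y (tail G a) ≡ false → Y (head G a) ≡ true → ⊥
    no-crossing-arc a Xt Xh Yt Yh = 1+n≰n (begin
      suc ℓ                                       ≡⟨ +-comm 1 ℓ ⟩
      ℓ + 1
        ≤⟨ +-mono-≤ (connected S ∪-proper) (#-pos (crossing X Y G) a
             (∧-true Xt (∧-true (cong not Yt) (∧-true (cong not Xh) Yh)))) ⟩
      inDegree G (X ∪ Y) + # (crossing X Y G)     ≤⟨ rest ⟩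
      ℓ ∎)
      where open ≤-Reasoning

  -- In `rev G` both `X` and `∁ Z` are tight, so this uncrosses an intersection: `y` lies in both
  -- sets and `z` in neither.
  diff-tight : ∀ {G X Z} → Stuck G → Tight (rev G) X → Tight G Z →
    ∃[ y ] X y ≡ true × Z y ≡ false → ∃[ z ] Z z ≡ true × X z ≡ false → Tight (rev G) (X ∩ ∁ Z)
  diff-tight S X-tight Z-tight (y , Xy , Zy) (z , Zz , Xz) =
    Uncrossing.∩-tight (stuck-rev S) X-tight (∁-tight Z-tight) (y , Xy , cong not Zy) Xz (cong not Zz)

  -- A tight set has at least k - ℓ more arcs of `F` leaving than entering. This excess is additive,
  -- since an arc between disjoint sets leaves one and enters the other. The bound also covers a
  -- union equal to V, to which `gain` does not apply.
  gain-⋃ : ∀ {G} → Stuck G → ∀ {Zs} → All (Tight G) Zs → AllPairs Disjoint Zs →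
    length Zs * k + inDegreeF G (⋃ Zs) ≤ length Zs * ℓ + inDegreeF (rev G) (⋃ Zs)
  gain-⋃ {G} S [] [] = count-≤ {m = m} (λ a → F a ∷ []) (λ _ → true)
    ((λ { (f ∷ []) → f ∧ false }) ∷ []) ((λ { (f ∷ []) → f ∧ false }) ∷ []) refl (λ _ → refl)
  gain-⋃ {G} S {Z ∷ Zs} (Z-tight ∷ tights) (disj ∷ disjs) =
    -- Adding the four degrees of `Z` and `U` to both sides replaces subtraction.
    +-cancelʳ-≤ (zi + zo + ui + uo) _ _ (begin
      k + N * k + wi + (zi + zo + ui + uo)       ≡⟨ lhs k (N * k) zi zo ui uo wi ⟩
      (k + zi) + (N * k + ui) + (wi + (zo + uo))
        ≤⟨ +-mono-≤ (+-mono-≤ Z-gain (gain-⋃ S tights disjs)) modular ⟩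
      (ℓ + zo) + (N * ℓ + uo) + (wo + (zi + ui)) ≡⟨ rhs ℓ (N * ℓ) zi zo ui uo wo ⟩
      ℓ + N * ℓ + wo + (zi + zo + ui + uo) ∎)
    where
    open ≤-Reasoning
    U = ⋃ Zs
    N = length Zs
    zi = inDegreeF G Z
    zo = inDegreeF (rev G) Z
    ui = inDegreeF G U
    uo = inDegreeF (rev G) U
    wi = inDegreeF G (Z ∪ U)
    wo = inDegreeF (rev G) (Z ∪ U)
    Z-gain : k + zi ≤ ℓ + zo
    Z-gain = ≤-trans (gain S (proj₁ Z-tight)) (+-monoˡ-≤ zo (proj₂ Z-tight))
    Z#U : Disjoint Z U
    Z#U Zv Uv with ⋃-∈ Zs Uv
    ... | Y , Y∈ , Yv = All.lookup disj Y∈ Zv Yv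
    modular : wi + (zo + uo) ≤ wo + (zi + ui)
    modular = count-≤ {m = m}
      (λ a → F a ∷ Z (tail G a) ∷ U (tail G a) ∷ Z (head G a) ∷ U (head G a) ∷ [])
      (λ { (f ∷ z ∷ u ∷ z′ ∷ u′ ∷ []) → not (z ∧ u) ∧ not (z′ ∧ u′) })
      ((λ { (f ∷ z ∷ u ∷ z′ ∷ u′ ∷ []) → f ∧ (not (z ∨ u) ∧ (z′ ∨ u′)) })
        ∷ (λ { (f ∷ z ∷ u ∷ z′ ∷ u′ ∷ []) → f ∧ (not z′ ∧ z) })
        ∷ (λ { (f ∷ z ∷ u ∷ z′ ∷ u′ ∷ []) → f ∧ (not u′ ∧ u) }) ∷ [])
      ((λ { (f ∷ z ∷ u ∷ z′ ∷ u′ ∷ []) → f ∧ (not (z′ ∨ u′) ∧ (z ∨ u)) })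
        ∷ (λ { (f ∷ z ∷ u ∷ z′ ∷ u′ ∷ []) → f ∧ (not z ∧ z′) })
        ∷ (λ { (f ∷ z ∷ u ∷ z′ ∷ u′ ∷ []) → f ∧ (not u ∧ u′) }) ∷ [])
      refl (λ a → ∧-true (excludes Z#U) (excludes Z#U))
    lhs : ∀ k Nk zi zo ui uo wi →
      k + Nk + wi + (zi + zo + ui + uo) ≡ (k + zi) + (Nk + ui) + (wi + (zo + uo))
    lhs = solve-∀
    rhs : ∀ ℓ Nℓ zi zo ui uo wo →
      (ℓ + zo) + (Nℓ + uo) + (wo + (zi + ui)) ≡ ℓ + Nℓ + wo + (zi + zo + ui + uo)
    rhs = solve-∀

  -- The point p lies outside W and all members of Zs meeting W, so that their union is proper.
  merge : ∀ {G} → Stuck G → ∀ Zs W p → All (Tight G) Zs → AllPairs Disjoint Zs → Tight G W →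
    W p ≡ false → (∀ {Z} → Z ∈ Zs → Meet Z W → Z p ≡ false) →
    ∃[ Zs′ ] All (Tight G) Zs′ × AllPairs Disjoint Zs′ × Refines (W ∷ Zs) Zs′ × ⋃ Zs′ ⊆ ⋃ (W ∷ Zs)
  merge S [] W p [] [] W-tight Wp away =
    W ∷ [] , W-tight ∷ [] , [] ∷ [] , (λ {X} X∈ → X , X∈ , λ Xv → Xv) , λ Uv → Uv
  merge S (Z ∷ Zs) W p (Z-tight ∷ tights) (disj ∷ disjs) W-tight Wp away with meet? Z W
  -- `W` absorbs `Z`. A later member is disjoint from `Z`, so if it meets `Z ∪ W` it already met `W`
  -- and still avoids `p`.
  ... | yes meet = absorbed
      (merge S Zs (Z ∪ W) p tights disjs
        (Uncrossing.∪-tight S Z-tight W-tight meet Zp Wp) (∨-false Zp Wp) away′)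
    where
    Zp = away (here refl) meet
    away′ : ∀ {Y} → Y ∈ Zs → Meet Y (Z ∪ W) → Y p ≡ false
    away′ Y∈ (v , Yv , ZWv) with ∨-true ZWv
    ... | inj₁ Zv = ⊥-elim (All.lookup disj Y∈ Zv Yv)
    ... | inj₂ Wv = away (there Y∈) (v , Yv , Wv)
    absorbed : ∃[ Zs′ ] All (Tight _) Zs′ × AllPairs Disjoint Zs′ × Refines (Z ∪ W ∷ Zs) Zs′
        × ⋃ Zs′ ⊆ ⋃ (Z ∪ W ∷ Zs) →
      ∃[ Zs′ ] All (Tight _) Zs′ × AllPairs Disjoint Zs′ × Refines (W ∷ Z ∷ Zs) Zs′
        × ⋃ Zs′ ⊆ ⋃ (W ∷ Z ∷ Zs)
    absorbed (Zs′ , tights′ , disjs′ , refines , cover) = Zs′ , tights′ , disjs′ , refines′ , cover′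
      where
      refines′ : Refines (W ∷ Z ∷ Zs) Zs′
      refines′ (here refl) with refines (here refl)
      ... | Y , Y∈ , ZW⊆Y = Y , Y∈ , λ {v} Wv → ZW⊆Y (∨-trueʳ (Z v) Wv)
      refines′ (there (here refl)) with refines (here refl)
      ... | Y , Y∈ , ZW⊆Y = Y , Y∈ , λ Zv → ZW⊆Y (∨-trueˡ Zv)
      refines′ (there (there X∈)) = refines (there X∈)
      cover′ : ⋃ Zs′ ⊆ ⋃ (W ∷ Z ∷ Zs)
      cover′ {v} Uv with ∨-true {(Z ∪ W) v} (cover Uv)
      ... | inj₂ Zsv = ∨-trueʳ (W v) (∨-trueʳ (Z v) Zsv)
      ... | inj₁ ZWv with ∨-true {Z v} ZWv
      ... | inj₁ Zv = ∨-trueʳ (W v) (∨-trueˡ Zv)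
      ... | inj₂ Wv = ∨-trueˡ Wv
  ... | no ¬meet = extended (merge S Zs W p tights disjs W-tight Wp (λ Y∈ → away (there Y∈)))
    where
    extended : ∃[ Zs′ ] All (Tight _) Zs′ × AllPairs Disjoint Zs′ × Refines (W ∷ Zs) Zs′
        × ⋃ Zs′ ⊆ ⋃ (W ∷ Zs) →
      ∃[ Zs′ ] All (Tight _) Zs′ × AllPairs Disjoint Zs′ × Refines (W ∷ Z ∷ Zs) Zs′
        × ⋃ Zs′ ⊆ ⋃ (W ∷ Z ∷ Zs)
    extended (Zs′ , tights′ , disjs′ , refines , cover) =
      Z ∷ Zs′ , Z-tight ∷ tights′ , All.tabulate apart ∷ disjs′ , refines′ , cover′
      where
      apart : ∀ {Y} → Y ∈ Zs′ → Disjoint Z Y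
      apart Y∈ {v} Zv Yv with ∨-true {W v} (cover (∈-⋃ Y∈ Yv))
      ... | inj₁ Wv = ¬meet (v , Zv , Wv)
      ... | inj₂ Uv with ⋃-∈ Zs Uv
      ... | X , X∈ , Xv = All.lookup disj X∈ Zv Xv
      refines′ : Refines (W ∷ Z ∷ Zs) (Z ∷ Zs′)
      refines′ (here refl) with refines (here refl)
      ... | Y , Y∈ , ⊆Y = Y , there Y∈ , ⊆Y
      refines′ (there (here refl)) = Z , here refl , λ Zv → Zv
      refines′ (there (there X∈)) with refines (there X∈)
      ... | Y , Y∈ , ⊆Y = Y , there Y∈ , ⊆Y
      cover′ : ⋃ (Z ∷ Zs′) ⊆ ⋃ (W ∷ Z ∷ Zs)
      cover′ {v} h with ∨-true {Z v} h
      ... | inj₁ Zv = ∨-trueʳ (W v) (∨-trueˡ Zv)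
      ... | inj₂ Uv with ∨-true {W v} (cover Uv)
      ... | inj₁ Wv = ∨-trueˡ Wv
      ... | inj₂ Zsv = ∨-trueʳ (W v) (∨-trueʳ (Z v) Zsv)

  -- If some vertex lies outside both sets, `a` is a forbidden crossing arc. Otherwise Z ∪ W = V,
  -- and V ∖ W is an out-tight subset of `Z` containing the tail of `a`, which `unnested` rules out.
  avoid : ∀ {G Z W} → Stuck G → Tight G Z → Tight G W → ∀ a →
    Z (tail G a) ≡ true → Z (head G a) ≡ false → W (tail G a) ≡ false → W (head G a) ≡ true →
    (∀ {Y} → Tight (rev G) Y → Y ⊆ Z → Y (tail G a) ≡ true → ⊥) → Meet Z W → ⊥
  avoid {G} {Z} {W} S Z-tight W-tight a Zt Zh Wt Wh unnested meet
    with any? (λ w → (Z w Bool.≟ false) ×-dec (W w Bool.≟ false))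
  ... | yes (w , Zw , Ww) = Uncrossing.no-crossing-arc S Z-tight W-tight meet Zw Ww a Zt Zh Wt Wh
  ... | no ¬w = unnested (∁-tight W-tight)
    (λ {v} ∁Wv → ¬-not λ Zv → ¬w (v , Zv , not-injective ∁Wv)) (cong not Wt)

  -- Walks from outside X to a vertex through arcs of F and members of Ys.  They ensure that whenever
  -- an arc of F enters a tight Z sticking out of X, some arc of F witnesses nesting in X ∖ Z or in
  -- X ∖ (Y ∪ Z) with Y a member of Ys (`trail-stays`), against the minimality of X.
  data Trail (G : Digraph n m) (X : VSet n) (Ys : List (VSet n)) : Fin n → Set where
    enter : ∀ a → F a ≡ true → X (tail G a) ≡ false → Trail G X Ys (head G a)
    step  : ∀ a → F a ≡ true → ⋃ Ys (tail G a) ≡ true → Trail G X Ys (tail G a) →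
            Trail G X Ys (head G a)
    same  : ∀ {Y v w} → Y ∈ Ys → Y v ≡ true → Y w ≡ true → Trail G X Ys w → Trail G X Ys v

  ⋃-mono : {Xs Ys : List (VSet n)} → Refines Xs Ys → ⋃ Xs ⊆ ⋃ Ys
  ⋃-mono {Xs} refines Uv with ⋃-∈ Xs Uv
  ... | X , X∈ , Xv with refines X∈
  ... | Y , Y∈ , X⊆Y = ∈-⋃ Y∈ (X⊆Y Xv)

  coarsen : ∀ {G X Ys Ys′ v} → Refines Ys Ys′ → Trail G X Ys v → Trail G X Ys′ v
  coarsen refines (enter a Fa Xt)     = enter a Fa Xt
  coarsen refines (step a Fa Ut tr)   = step a Fa (⋃-mono refines Ut) (coarsen refines tr)
  coarsen refines (same Y∈ Yv Yw tr) with refines Y∈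
  ... | Y′ , Y′∈ , Y⊆Y′ = same Y′∈ (Y⊆Y′ Yv) (Y⊆Y′ Yw) (coarsen refines tr)

  -- Excluding nested tight and out-tight sets

  NestFree : ℕ → Set
  -- Induction is on the bound `s`; `G` is quantified because the hypothesis is also applied to
  -- `rev G`.
  NestFree s = ∀ {G} → Stuck G → ∀ {X} → # X < s → Tight (rev G) X → ∀ {Y} → Tight G Y → Y ⊆ X →
    ∀ a → F a ≡ true → Y (head G a) ≡ true → X (tail G a) ≡ false → ⊥

  module Nested {s G X} (smaller : NestFree s) (S : Stuck G) (#X≤s : # X < suc s)
    (X-tight : Tight (rev G) X) where

    -- As `Z` sticks out of `X` and misses `Y`, the set X ∖ Z is out-tight, contains `Y`, and is
    -- smaller than `X` because it loses `u`. The arc `a` enters `Y` from outside X ∖ Z, against the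
    -- induction hypothesis.
    escape : ∀ {Y Z} → Tight G Y → Y ⊆ X → Tight G Z → (Meet Y Z → ⊥) →
      ∃[ z ] Z z ≡ true × X z ≡ false → ∃[ u ] Z u ≡ true × X u ≡ true →
      ∀ a → F a ≡ true → Y (head G a) ≡ true → (X ∩ ∁ Z) (tail G a) ≡ false → ⊥
    escape {Y} {Z} Y-tight Y⊆X Z-tight apart outside (u , Zu , Xu) a Fa Yh left =
      smaller S (<-≤-trans (#-⊂ {X = X ∩ ∁ Z} {Y = X} {u = u} ∧-trueˡ (∧-false Xu Zu) Xu) (≤-pred #X≤s))
        (diff-tight S X-tight Z-tight (head G a , Y⊆X Yh , off Yh) outside)
        Y-tight (λ Yv → ∧-true (Y⊆X Yv) (cong not (off Yv))) a Fa Yh left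
      where
      off : ∀ {v} → Y v ≡ true → Z v ≡ false
      off Yv = ¬-not λ Zv → apart (_ , Yv , Zv)
      ∧-false : ∀ {b c} → b ≡ true → c ≡ true → b ∧ not c ≡ false
      ∧-false refl refl = refl

    module _ {Ys} (tights : All (Tight G) Ys) (disjs : AllPairs Disjoint Ys) (U⊆X : ⋃ Ys ⊆ X) where

      -- Follows the trail backwards. If its last arc comes from outside `X`, `escape` applies to
      -- `Z`. If that arc comes from a member `Y′`, then either `Y′` misses `Z` and the walk is
      -- traced further back, or `Y′ ∪ Z` is tight and `escape` applies to it.
      trail-stays : ∀ {v Z} → Trail G X Ys v → Tight G Z →
        ∃[ z ] Z z ≡ true × X z ≡ false → ∃[ u ] Z u ≡ true × X u ≡ true →
        ⋃ Ys v ≡ true → (∀ {Y} → Y ∈ Ys → Y v ≡ true → Meet Y Z → ⊥) → ⊥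
      trail-stays (enter a Fa Xt) Z-tight outside inside Uv apart with ⋃-∈ Ys Uv
      ... | Y , Y∈ , Yv = escape (All.lookup tights Y∈) (λ h → U⊆X (∈-⋃ Y∈ h)) Z-tight (apart Y∈ Yv)
        outside inside a Fa Yv (cong (_∧ _) Xt)
      trail-stays (same {Y} Y∈ Yv Yw tr) Z-tight outside inside Uv apart =
        trail-stays tr Z-tight outside inside (∈-⋃ Y∈ Yw) apart′
        where
        apart′ : ∀ {Y′} → Y′ ∈ Ys → Y′ _ ≡ true → Meet Y′ _ → ⊥
        apart′ Y′∈ Y′w with same-block disjs Y∈ Y′∈ Yw Y′w
        ... | refl = apart Y∈ Yv
      trail-stays {Z = Z} (step a Fa Ut tr) Z-tight (z , Zz , Xz) (u , Zu , Xu) Uv apart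
        with ⋃-∈ Ys Uv | ⋃-∈ Ys Ut
      ... | Y , Y∈ , Yh | Y′ , Y′∈ , Y′t with meet? Y′ Z
      ... | no ¬meet = trail-stays tr Z-tight (z , Zz , Xz) (u , Zu , Xu) Ut apart′
        where
        apart′ : ∀ {Y″} → Y″ ∈ Ys → Y″ _ ≡ true → Meet Y″ _ → ⊥
        apart′ Y″∈ Y″t with same-block disjs Y′∈ Y″∈ Y′t Y″t
        ... | refl = ¬meet
      ... | yes meet = escape (All.lookup tights Y∈) (λ h → U⊆X (∈-⋃ Y∈ h))
          (Uncrossing.∪-tight S (All.lookup tights Y′∈) Z-tight meet Y′h
            (¬-not λ Zh → apart Y∈ Yh (_ , Yh , Zh)))
          apart′ (z , ∨-trueʳ (Y′ z) Zz , Xz) (u , ∨-trueʳ (Y′ u) Zu , Xu) a Fa Yh left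
        where
        Y′h : Y′ (head G a) ≡ false
        Y′h = ¬-not λ h → apart Y′∈ h meet
        apart′ : Meet Y (Y′ ∪ Z) → ⊥
        apart′ (v , Yv , Y′Zv) with ∨-true {Y′ v} Y′Zv
        ... | inj₂ Zv = apart Y∈ Yh (v , Yv , Zv)
        ... | inj₁ Y′v with same-block disjs Y∈ Y′∈ Yv Y′v
        ... | refl = true≢false Yh Y′h
        left : (X ∩ ∁ (Y′ ∪ Z)) (tail G a) ≡ false
        left rewrite Y′t with X (tail G a)
        ... | true  = refl
        ... | false = refl

    entering leaving : VSet n → ℕ
    entering U = # λ a → F a ∧ (U (head G a) ∧ not (X (tail G a)))
    leaving  U = # λ a → F a ∧ (U (tail G a) ∧ not (X (head G a)))

    entering≤ : ∀ U → U ⊆ X → entering U ≤ inDegreeF G U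
    entering≤ U U⊆X = count-≤ {m = m}
      (λ a → F a ∷ U (tail G a) ∷ U (head G a) ∷ X (tail G a) ∷ [])
      (λ { (f ∷ u ∷ u′ ∷ x ∷ []) → not u ∨ x })
      ((λ { (f ∷ u ∷ u′ ∷ x ∷ []) → f ∧ (u′ ∧ not x) }) ∷ [])
      ((λ { (f ∷ u ∷ u′ ∷ x ∷ []) → f ∧ (not u ∧ u′) }) ∷ [])
      refl (λ a → implies U⊆X)

    leaving≤ℓ : ∀ U → U ⊆ X → leaving U ≤ ℓ
    leaving≤ℓ U U⊆X = ≤-trans (count-≤ {m = m}
      (λ a → F a ∷ U (tail G a) ∷ X (tail G a) ∷ X (head G a) ∷ [])
      (λ { (f ∷ u ∷ x ∷ x′ ∷ []) → not u ∨ x })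
      ((λ { (f ∷ u ∷ x ∷ x′ ∷ []) → f ∧ (u ∧ not x′) }) ∷ [])
      ((λ { (f ∷ u ∷ x ∷ x′ ∷ []) → not x′ ∧ x }) ∷ [])
      refl (λ a → implies U⊆X)) (proj₂ X-tight)

    ≤leaving : ∀ U →
      ¬ (∃[ a ] F a ≡ true × U (tail G a) ≡ true × U (head G a) ≡ false × X (head G a) ≡ true) →
      inDegreeF (rev G) U ≤ leaving U
    ≤leaving U stay = count-≤ {m = m}
      (λ a → F a ∷ U (tail G a) ∷ U (head G a) ∷ X (head G a) ∷ [])
      (λ { (f ∷ u ∷ u′ ∷ x ∷ []) → not (f ∧ (u ∧ (not u′ ∧ x))) })
      ((λ { (f ∷ u ∷ u′ ∷ x ∷ []) → f ∧ (not u′ ∧ u) }) ∷ [])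
      ((λ { (f ∷ u ∷ u′ ∷ x ∷ []) → f ∧ (u ∧ not x) }) ∷ [])
      refl (λ a → cong not (¬-not λ h → stay (a , ∧-trueˡ h
        , ∧-trueˡ (∧-trueʳ {F a} h)
        , not-injective (∧-trueˡ (∧-trueʳ {U (tail G a)} (∧-trueʳ {F a} h)))
        , ∧-trueʳ {not (U (head G a))} (∧-trueʳ {U (tail G a)} (∧-trueʳ {F a} h)))))

    -- d⁺(X) + d⁻(Y) is at most 2ℓ and counts d⁺(X ∖ Y) together with all arcs between `Y` and V ∖
    -- X, in either direction. If X ∖ Y is nonempty it takes at least `ℓ` of the sum.
    between≤ℓ : ∀ {Y} → Tight G Y → Y ⊆ X → entering (⋃ (Y ∷ [])) + leaving (⋃ (Y ∷ [])) ≤ ℓ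
    between≤ℓ {Y} Y-tight Y⊆X with ⊆-or-escape X Y
    ... | inj₂ (y , Xy , Yy) = +-cancelˡ-≤ ℓ _ _ (begin
        ℓ + (entering U + leaving U)
          ≤⟨ +-monoˡ-≤ _ (connected (stuck-rev S) diff-proper) ⟩
        inDegree (rev G) (X ∩ ∁ Y) + (entering U + leaving U)
          ≤⟨ count-≤ {m = m}
               (λ a → F a ∷ X (tail G a) ∷ X (head G a) ∷ Y (tail G a) ∷ Y (head G a) ∷ [])
               (λ { (f ∷ x ∷ x′ ∷ y ∷ y′ ∷ []) → (not y ∨ x) ∧ (not y′ ∨ x′) })
               ((λ { (f ∷ x ∷ x′ ∷ y ∷ y′ ∷ []) → not (x′ ∧ not y′) ∧ (x ∧ not y) })
                 ∷ (λ { (f ∷ x ∷ x′ ∷ y ∷ y′ ∷ []) → f ∧ ((y′ ∨ false) ∧ not x) })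
                 ∷ (λ { (f ∷ x ∷ x′ ∷ y ∷ y′ ∷ []) → f ∧ ((y ∨ false) ∧ not x′) }) ∷ [])
               ((λ { (f ∷ x ∷ x′ ∷ y ∷ y′ ∷ []) → not x′ ∧ x })
                 ∷ (λ { (f ∷ x ∷ x′ ∷ y ∷ y′ ∷ []) → not y ∧ y′ }) ∷ [])
               refl (λ a → ∧-true (implies Y⊆X) (implies Y⊆X)) ⟩
        inDegree (rev G) X + inDegree G Y   ≤⟨ +-mono-≤ (proj₂ X-tight) (proj₂ Y-tight) ⟩
        ℓ + ℓ ∎)
      where
      open ≤-Reasoning
      U = ⋃ (Y ∷ [])
      diff-proper : Proper (X ∩ ∁ Y)
      diff-proper with proj₂ (proj₁ X-tight)
      ... | w , Xw = (y , ∧-true Xy (cong not Yy)) , (w , cong (_∧ not (Y w)) Xw)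
    -- Now X = Y is both tight and out-tight, so its excess of `F`-arcs would be positive in both
    -- directions.
    ... | inj₁ X⊆Y = ⊥-elim (<-irrefl refl (begin-strict
        k + inDegreeF G Y                          ≤⟨ gain S (proj₁ Y-tight) ⟩
        inDegree G Y + inDegreeF (rev G) Y         ≤⟨ +-monoˡ-≤ _ (proj₂ Y-tight) ⟩
        ℓ + inDegreeF (rev G) Y                    <⟨ +-monoˡ-< _ ℓ<k ⟩
        k + inDegreeF (rev G) Y                    ≤⟨ +-monoʳ-≤ k (inDegreeF-cong (rev G) {Y} {X} Y⊆X X⊆Y) ⟩
        k + inDegreeF (rev G) X                    ≤⟨ gain (stuck-rev S) (proj₁ X-tight) ⟩
        inDegree (rev G) X + inDegreeF G X         ≤⟨ +-monoˡ-≤ _ (proj₂ X-tight) ⟩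
        ℓ + inDegreeF G X                          ≤⟨ +-monoˡ-≤ _ (<⇒≤ ℓ<k) ⟩
        k + inDegreeF G X                          ≤⟨ +-monoʳ-≤ k (inDegreeF-cong G {X} {Y} X⊆Y Y⊆X) ⟩
        k + inDegreeF G Y ∎))
      where
      open ≤-Reasoning
      inDegreeF-cong : ∀ (H : Digraph n m) {P Q} → P ⊆ Q → Q ⊆ P → inDegreeF H P ≤ inDegreeF H Q
      inDegreeF-cong H {P} {Q} P⊆Q Q⊆P = count-≤ {m = m}
        (λ a → F a ∷ P (tail H a) ∷ Q (tail H a) ∷ P (head H a) ∷ Q (head H a) ∷ [])
        (λ { (f ∷ p ∷ q ∷ p′ ∷ q′ ∷ []) → (not q ∨ p) ∧ (not p′ ∨ q′) })
        ((λ { (f ∷ p ∷ q ∷ p′ ∷ q′ ∷ []) → f ∧ (not p ∧ p′) }) ∷ [])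
        ((λ { (f ∷ p ∷ q ∷ p′ ∷ q′ ∷ []) → f ∧ (not q ∧ q′) }) ∷ [])
        refl (λ a → ∧-true (implies Q⊆P) (implies P⊆Q))

    -- A single member is excluded by counting arcs between it and V ∖ X, two or more by d⁺(X) ≤ ℓ.
    closed-impossible : ∀ {Ys} → All (Tight G) Ys → AllPairs Disjoint Ys → ⋃ Ys ⊆ X →
      1 ≤ entering (⋃ Ys) →
      ¬ (∃[ a ] F a ≡ true × ⋃ Ys (tail G a) ≡ true × ⋃ Ys (head G a) ≡ false × X (head G a) ≡ true) →
      ⊥
    closed-impossible {Ys} tights disjs U⊆X pos stay = go Ys tights disjs U⊆X pos balance
      where
      balance : length Ys * k + entering (⋃ Ys) ≤ length Ys * ℓ + leaving (⋃ Ys)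
      balance = ≤-trans (+-monoʳ-≤ (length Ys * k) (entering≤ (⋃ Ys) U⊆X))
        (≤-trans (gain-⋃ S tights disjs) (+-monoʳ-≤ (length Ys * ℓ) (≤leaving (⋃ Ys) stay)))
      go : ∀ Ys → All (Tight G) Ys → AllPairs Disjoint Ys → ⋃ Ys ⊆ X → 1 ≤ entering (⋃ Ys) →
        length Ys * k + entering (⋃ Ys) ≤ length Ys * ℓ + leaving (⋃ Ys) → ⊥
      go [] _ _ U⊆X pos balance = 1+n≰n (≤-trans pos (count-≤ {m = m} (λ a → F a ∷ []) (λ _ → true)
        ((λ { (f ∷ []) → f ∧ false }) ∷ []) [] refl (λ _ → refl)))
      -- `balance` reads k + i ≤ ℓ + o. Adding i and using i + o ≤ ℓ gives k + 2i ≤ 2ℓ ≤ k + 1,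
      -- against i ≥ 1.
      go (Y ∷ []) (Y-tight ∷ []) _ U⊆X pos balance = 1+n≰n (begin
          suc (suc k)                      ≡⟨ +-comm 2 k ⟩
          k + (1 + 1)                      ≤⟨ +-monoʳ-≤ k (+-mono-≤ pos pos) ⟩
          k + (i + i)                      ≡⟨ shuffle k i ⟩
          1 * k + i + i                    ≤⟨ +-monoˡ-≤ i balance ⟩
          1 * ℓ + o + i                    ≡⟨ shuffle′ ℓ i o ⟩
          ℓ + (i + o)
            ≤⟨ +-monoʳ-≤ ℓ (between≤ℓ Y-tight (λ Yv → U⊆X (∨-trueˡ Yv))) ⟩
          ℓ + ℓ                            ≤⟨ 2ℓ≤1+k ⟩
          suc k ∎)
        where
        open ≤-Reasoning
        i = entering (⋃ (Y ∷ []))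
        o = leaving (⋃ (Y ∷ []))
        shuffle : ∀ k i → k + (i + i) ≡ 1 * k + i + i
        shuffle = solve-∀
        shuffle′ : ∀ ℓ i o → 1 * ℓ + o + i ≡ ℓ + (i + o)
        shuffle′ = solve-∀
      -- Two members would give 2k + 1 ≤ 3ℓ, whereas 2ℓ ≤ k + 1 and ℓ + 1 ≤ k add up to 3ℓ ≤ 2k. The
      -- other `t` members add k each on the left and only ℓ on the right.
      go Ys@(Y ∷ Y′ ∷ Ys′) _ _ U⊆X pos balance = 1+n≰n (begin
          suc ((2 + t) * ℓ + ℓ)            ≡⟨ shuffle t ℓ ⟩
          ℓ + ℓ + (suc ℓ + t * ℓ)          ≤⟨ +-mono-≤ 2ℓ≤1+k (+-mono-≤ ℓ<k (*-monoʳ-≤ t (<⇒≤ ℓ<k))) ⟩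
          suc k + (k + t * k)              ≡⟨ shuffle′ t k ⟩
          (2 + t) * k + 1                  ≤⟨ +-monoʳ-≤ ((2 + t) * k) pos ⟩
          (2 + t) * k + entering (⋃ Ys)    ≤⟨ balance ⟩
          (2 + t) * ℓ + leaving (⋃ Ys)     ≤⟨ +-monoʳ-≤ ((2 + t) * ℓ) (leaving≤ℓ (⋃ Ys) U⊆X) ⟩
          (2 + t) * ℓ + ℓ ∎)
        where
        open ≤-Reasoning
        t = length Ys′
        shuffle : ∀ t ℓ → suc ((2 + t) * ℓ + ℓ) ≡ ℓ + ℓ + (suc ℓ + t * ℓ)
        shuffle = solve-∀
        shuffle′ : ∀ t k → suc k + (k + t * k) ≡ (2 + t) * k + 1
        shuffle′ = solve-∀

    module _ {a₀} (Fa₀ : F a₀ ≡ true) (Xt₀ : X (tail G a₀) ≡ false) where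

      -- While an arc of `F` runs from the union to the rest of `X`, the tight set `W` that it
      -- enters is merged in: `trail-stays` forces `W` into `X`, and `apart` keeps the tail out of
      -- every member meeting `W`. Each round adds the head to the union, so `fuel` suffices.
      grow : ∀ fuel Ys → All (Tight G) Ys → AllPairs Disjoint Ys → ⋃ Ys ⊆ X →
        (∀ {v} → ⋃ Ys v ≡ true → Trail G X Ys v) → ⋃ Ys (head G a₀) ≡ true →
        n < fuel + # (⋃ Ys) → ⊥
      grow zero Ys _ _ _ _ _ big = <⇒≱ big (#≤n (⋃ Ys))
      grow (suc fuel) Ys tights disjs U⊆X trails Uh₀ big
        with any? (λ a → (F a Bool.≟ true) ×-dec (⋃ Ys (tail G a) Bool.≟ true)
                   ×-dec (⋃ Ys (head G a) Bool.≟ false) ×-dec (X (head G a) Bool.≟ true))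
      ... | no stay = closed-impossible tights disjs U⊆X
          (#-pos (λ a → F a ∧ (⋃ Ys (head G a) ∧ not (X (tail G a)))) a₀
            (∧-true Fa₀ (∧-true Uh₀ (cong not Xt₀)))) stay
      ... | yes (a , Fa , Ut , Uh , Xh) with covered S a Fa
      ... | W , W-tight , Wt , Wh = extend (⊆-or-escape W X)
        where
        apart : ∀ {Y} → Y ∈ Ys → Y (tail G a) ≡ true → Meet Y W → ⊥
        apart {Y} Y∈ Yt = avoid S (All.lookup tights Y∈) W-tight a Yt Yh Wt Wh
          -- In `rev G` this is a forbidden nesting with outer set `Y`, which is smaller than `X` as
          -- it misses the head of `a`.
          λ Y′-tight Y′⊆Y Y′t → smaller (stuck-rev S)
            (<-≤-trans (#-⊂ {X = Y} {Y = X} {u = head G a} (λ Yv → U⊆X (∈-⋃ Y∈ Yv)) Yh Xh) (≤-pred #X≤s))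
            (All.lookup tights Y∈) Y′-tight Y′⊆Y a Fa Y′t Yh
          where
          Yh : Y (head G a) ≡ false
          Yh = ¬-not λ Yh → true≢false (∈-⋃ Y∈ Yh) Uh
        extend : W ⊆ X ⊎ ∃[ z ] W z ≡ true × X z ≡ false → ⊥
        extend (inj₂ outside) =
          trail-stays tights disjs U⊆X (trails Ut) W-tight outside (head G a , Wh , Xh) Ut apart
        extend (inj₁ W⊆X)
          with merge S Ys W (tail G a) tights disjs W-tight Wt (λ Y∈ meet → ¬-not λ Yt → apart Y∈ Yt meet)
        ... | Ys′ , tights′ , disjs′ , refines , cover =
          grow fuel Ys′ tights′ disjs′ U′⊆X trails′ (U⊆U′ Uh₀)
            (<-≤-trans big (≤-trans (≤-reflexive (sym (+-suc fuel _)))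
              (+-monoʳ-≤ fuel (#-⊂ {X = ⋃ Ys} {Y = ⋃ Ys′} {u = head G a} U⊆U′ Uh U′h))))
          where
          refines′ : Refines Ys Ys′
          refines′ Y∈ = refines (there Y∈)
          U⊆U′ : ⋃ Ys ⊆ ⋃ Ys′
          U⊆U′ = ⋃-mono refines′
          U′h : ⋃ Ys′ (head G a) ≡ true
          U′h = ⋃-mono refines (∨-trueˡ Wh)
          U′⊆X : ⋃ Ys′ ⊆ X
          U′⊆X {v} U′v with ∨-true {W v} (cover U′v)
          ... | inj₁ Wv = W⊆X Wv
          ... | inj₂ Uv = U⊆X Uv
          trails′ : ∀ {v} → ⋃ Ys′ v ≡ true → Trail G X Ys′ v
          trails′ {v} U′v with ∨-true {W v} (cover U′v)
          ... | inj₂ Uv = coarsen refines′ (trails Uv)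
          -- A vertex of `W` shares its new member with the head of `a`, which is reached from the
          -- old union through `a`.
          ... | inj₁ Wv with refines (here refl)
          ... | Y′ , Y′∈ , W⊆Y′ = same Y′∈ (W⊆Y′ Wv) (W⊆Y′ Wh)
            (step a Fa (U⊆U′ Ut) (coarsen refines′ (trails Ut)))

  -- The family grown inside `X` starts from `Y` alone, all of whose vertices are reached from
  -- outside `X` through `a`.
  nest-free : ∀ s → NestFree s
  nest-free (suc s) {G} S {X} #X≤s X-tight {Y} Y-tight Y⊆X a Fa Yh Xt =
    Nested.grow (nest-free s) S #X≤s X-tight Fa Xt n (Y ∷ []) (Y-tight ∷ []) ([] ∷ []) U⊆X
      (λ Uv → same (here refl) (U⊆Y Uv) Yh (enter a Fa Xt)) (∨-trueˡ Yh)
      (m<m+n n (#-pos (⋃ (Y ∷ [])) (head G a) (∨-trueˡ Yh)))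
    where
    U⊆Y : ⋃ (Y ∷ []) ⊆ Y
    U⊆Y {v} Uv with ∨-true {Y v} Uv
    ... | inj₁ Yv = Yv
    U⊆X : ⋃ (Y ∷ []) ⊆ X
    U⊆X Uv = Y⊆X (U⊆Y Uv)

  -- Enlarging a disjoint family of tight sets without end

  expand : ∀ {G} → Stuck G → ∀ fuel Z Zs → All (Tight G) (Z ∷ Zs) → AllPairs Disjoint (Z ∷ Zs) →
    n < fuel + # (⋃ (Z ∷ Zs)) → ⊥
  expand S zero Z Zs _ _ big = <⇒≱ big (#≤n (⋃ (Z ∷ Zs)))
  expand {G} S (suc fuel) Z Zs tights disjs big
    with any? (λ a → (F a Bool.≟ true) ×-dec (⋃ (Z ∷ Zs) (tail G a) Bool.≟ true)
               ×-dec (⋃ (Z ∷ Zs) (head G a) Bool.≟ false))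
  -- With no arc of `F` leaving the union its excess is not positive, yet each of the at least one
  -- members contributes k - ℓ or more.
  ... | no stay = <⇒≱ (*-monoʳ-< (suc (length Zs)) ℓ<k) (begin
      N * k                                   ≤⟨ m≤m+n _ _ ⟩
      N * k + inDegreeF G U                   ≤⟨ gain-⋃ S tights disjs ⟩
      N * ℓ + inDegreeF (rev G) U             ≤⟨ +-monoʳ-≤ (N * ℓ) none ⟩
      N * ℓ + 0                               ≡⟨ +-identityʳ _ ⟩
      N * ℓ ∎)
    where
    open ≤-Reasoning
    N = suc (length Zs)
    U = ⋃ (Z ∷ Zs)
    none : inDegreeF (rev G) U ≤ 0
    none = count-≤ {m = m} (λ a → F a ∷ U (tail G a) ∷ U (head G a) ∷ [])
      (λ { (f ∷ u ∷ u′ ∷ []) → not (f ∧ (u ∧ not u′)) })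
      ((λ { (f ∷ u ∷ u′ ∷ []) → f ∧ (not u′ ∧ u) }) ∷ []) [] refl
      (λ a → cong not (¬-not λ h → stay (a , ∧-trueˡ h , ∧-trueˡ (∧-trueʳ {F a} h)
        , not-injective (∧-trueʳ {U (tail G a)} (∧-trueʳ {F a} h)))))
  ... | yes (a , Fa , Ut , Uh) with covered S a Fa
  ... | W , W-tight , Wt , Wh
    with merge S (Z ∷ Zs) W (tail G a) tights disjs W-tight Wt (λ Y∈ meet → ¬-not λ Yt → apart Y∈ Yt meet)
    where
    apart : ∀ {Y} → Y ∈ Z ∷ Zs → Y (tail G a) ≡ true → Meet Y W → ⊥
    apart {Y} Y∈ Yt = avoid S (All.lookup tights Y∈) W-tight a Yt Yh Wt Wh
      λ Y′-tight Y′⊆Y Y′t → nest-free (suc (# Y)) (stuck-rev S) ≤-refl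
        (All.lookup tights Y∈) Y′-tight Y′⊆Y a Fa Y′t Yh
      where
      Yh : Y (head G a) ≡ false
      Yh = ¬-not λ Yh → true≢false (∈-⋃ Y∈ Yh) Uh
  -- The merged family is nonempty, since one of its members contains `W`.
  ... | [] , _ , _ , refines , _ with refines (here refl)
  ... | _ , () , _
  expand {G} S (suc fuel) Z Zs tights disjs big | yes (a , Fa , Ut , Uh) | W , W-tight , Wt , Wh
      | Z′ ∷ Zs′ , tights′ , disjs′ , refines , _ =
    expand S fuel Z′ Zs′ tights′ disjs′
      (<-≤-trans big (≤-trans (≤-reflexive (sym (+-suc fuel _)))
        (+-monoʳ-≤ fuel (#-⊂ {X = ⋃ (Z ∷ Zs)} {Y = ⋃ (Z′ ∷ Zs′)} {u = head G a}
          (⋃-mono (λ X∈ → refines (there X∈))) Uh (⋃-mono refines (∨-trueˡ Wh))))))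

  not-stuck : ∀ {G X} → Stuck G → Tight G X → ⊥
  not-stuck {G} {X} S X-tight = expand S (suc n) X [] (X-tight ∷ []) ([] ∷ []) (m≤m+n (suc n) _)

-- Arc-connectivity as a minimum over proper vertex sets

module _ {A : Set} (p : A → Bool) (w : A → ℕ) where

  -- The fold inside `arcConn` with its filter and weight abstracted; at `isNonemptyProper` and
  -- `inDeg` the two agree definitionally.
  minOver : List A → ℕ∞
  minOver = foldr (λ x r → if p x then min∞ (just (w x)) r else r) nothing

  minOver-lower : ∀ {c x} xs → just c ≤∞ minOver xs → x ∈ xs → p x ≡ true → c ≤ w x
  minOver-lower (x ∷ xs) le (here refl) px rewrite px with minOver xs
  ... | nothing = le
  ... | just y  = ≤-trans le (m⊓n≤m _ y)
  minOver-lower (y ∷ xs) le (there x∈) px with p y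
  ... | false = minOver-lower xs le x∈ px
  ... | true with minOver xs in eq
  ... | nothing = minOver-lower xs (subst (_ ≤∞_) (sym eq) _) x∈ px
  ... | just z  = minOver-lower xs (subst (_ ≤∞_) (sym eq) (≤-trans le (m⊓n≤n (w y) z))) x∈ px

  minOver-greatest : ∀ {c} xs → (∀ x → p x ≡ true → c ≤ w x) → just c ≤∞ minOver xs
  minOver-greatest []       le = _
  minOver-greatest (x ∷ xs) le with p x in px | minOver xs | minOver-greatest xs le
  ... | false | _       | rest = rest
  ... | true  | nothing | _    = le x px
  ... | true  | just _  | rest = ⊓-glb (le x px) rest

  minOver-attained : ∀ {c} xs → minOver xs ≡ just c → ∃[ x ] p x ≡ true × w x ≡ c
  minOver-attained (x ∷ xs) eq with p x in px | minOver xs in rest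
  ... | false | _ = minOver-attained xs (trans rest eq)
  minOver-attained (x ∷ xs) refl | true | nothing = x , px , refl
  minOver-attained (x ∷ xs) refl | true | just y with ⊓-sel (w x) y
  ... | inj₁ eq = x , px , sym eq
  ... | inj₂ eq = minOver-attained xs (trans rest (cong just (sym eq)))

∈-allSubsets : ∀ {n} (X : Subset n) → X ∈ allSubsets n
∈-allSubsets []          = here refl
∈-allSubsets (true ∷ X)  = ∈-++⁺ˡ (∈-map⁺ (true ∷_) (∈-allSubsets X))
∈-allSubsets {suc n} (false ∷ X) =
  ∈-++⁺ʳ (map (true ∷_) (allSubsets n)) (∈-map⁺ (false ∷_) (∈-allSubsets X))

≡ᵇ-false : ∀ {i j} → i ≢ j → not (i ≡ᵇ j) ≡ true
≡ᵇ-false {i} {j} i≢j with i ≡ᵇ j in eq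
... | true  = ⊥-elim (i≢j (≡ᵇ⇒≡ i j (Equivalence.from T-≡ eq)))
... | false = refl

≡ᵇ-true : ∀ {i j} → i ≡ j → not (i ≡ᵇ j) ≡ false
≡ᵇ-true {i} {j} i≡j = cong not (Equivalence.to T-≡ (≡⇒≡ᵇ i j i≡j))

#-cong : ∀ {m} {p q : Fin m → Bool} → (∀ a → p a ≡ q a) → # p ≡ # q
#-cong {m} p≗q = go (allFinList m)
  where
  go : ∀ xs → count _ xs ≡ count _ xs
  go []       = refl
  go (x ∷ xs) = cong₂ (λ b c → indicator b + c) (p≗q x) (go xs)

proper⇒true : ∀ {n} (X : Subset n) → Proper (lookup X) → isNonemptyProper X ≡ true
proper⇒true {n} X ((v , Xv) , (w , Xw)) = ∧-true
  (≡ᵇ-false λ eq → 1+n≰n (subst (1 ≤_) eq (#-pos (lookup X) v Xv)))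
  (≡ᵇ-false λ eq → 1+n≰n (subst (_< n) eq
    (subst (# (lookup X) <_) (#-all n) (#-⊂ {X = lookup X} {Y = λ _ → true} {u = w} (λ _ → refl) Xw refl))))

true⇒proper : ∀ {n} (X : Subset n) → isNonemptyProper X ≡ true → Proper (lookup X)
true⇒proper {n} X h = nonempty , nonfull
  where
  nonempty : ∃[ v ] lookup X v ≡ true
  nonempty with any? (λ v → lookup X v Bool.≟ true)
  ... | yes e = e
  ... | no ¬e = ⊥-elim (true≢false (∧-trueˡ h) (≡ᵇ-true {# (lookup X)} (n≤0⇒n≡0
    (count-≤ {m = n} (λ v → lookup X v ∷ []) (λ { (x ∷ []) → not x })
      ((λ { (x ∷ []) → x }) ∷ []) [] refl (λ v → cong not (¬-not λ Xv → ¬e (v , Xv)))))))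
  nonfull : ∃[ w ] lookup X w ≡ false
  nonfull with any? (λ v → lookup X v Bool.≟ false)
  ... | yes e = e
  ... | no ¬e = ⊥-elim (true≢false (∧-trueʳ {not (# (lookup X) ≡ᵇ 0)} h) (≡ᵇ-true {# (lookup X)}
    (trans (#-cong λ v → ¬-not λ Xv → ¬e (v , Xv)) (#-all n))))

module _ {n m : ℕ} (D : Digraph n m) where

  arcConn-lower : ∀ {c X} → just c ≤∞ arcConn D → Proper X → c ≤ inDegree D X
  arcConn-lower {c} {X} le proper = subst (c ≤_)
    (#-cong λ a → cong₂ (λ t h → not t ∧ h) (lookup∘tabulate X (tail D a)) (lookup∘tabulate X (head D a)))
    (minOver-lower isNonemptyProper (inDeg D) (allSubsets n) le (∈-allSubsets (tabulate X))
      (proper⇒true (tabulate X) (tabulated proper)))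
    where
    tabulated : Proper X → Proper (lookup (tabulate X))
    tabulated ((v , Xv) , (w , Xw)) =
      (v , trans (lookup∘tabulate X v) Xv) , (w , trans (lookup∘tabulate X w) Xw)

  arcConn-greatest : ∀ {c} → (∀ {X} → Proper X → c ≤ inDegree D X) → just c ≤∞ arcConn D
  arcConn-greatest le = minOver-greatest isNonemptyProper (inDeg D) (allSubsets n)
    (λ X h → le (true⇒proper X h))

  arcConn-attained : ∀ {c} → arcConn D ≡ just c → ∃[ X ] Proper X × inDegree D X ≡ c
  arcConn-attained eq with minOver-attained isNonemptyProper (inDeg D) (allSubsets n) eq
  ... | X , h , deg = lookup X , true⇒proper X h , deg

_≤∞?_ : ∀ x y → Dec (x ≤∞ y)
just c  ≤∞? nothing = yes _
nothing ≤∞? nothing = yes _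
nothing ≤∞? just _  = no λ ()
just c  ≤∞? just d  = c ≤? d

-- Reversing a single arc

≟-suc : ∀ {m} (b a : Fin m) → ⌊ suc b Fin.≟ suc a ⌋ ≡ ⌊ b Fin.≟ a ⌋
≟-suc b a = trans (isYes≗does (suc b Fin.≟ suc a)) (sym (isYes≗does (b Fin.≟ a)))

#-singleton : ∀ {m} (a : Fin m) → # (λ b → ⌊ b Fin.≟ a ⌋) ≤ 1
#-singleton {suc m} zero rewrite count-map suc (λ b → ⌊ b Fin.≟ zero ⌋) (allFinList m) =
  s≤s (count-≤ {m = m} (λ _ → []) (λ _ → true) ((λ _ → false) ∷ []) [] refl (λ _ → refl))
#-singleton {suc m} (suc a) rewrite count-map suc (λ b → ⌊ b Fin.≟ suc a ⌋) (allFinList m) =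
  subst (_≤ 1) (sym (#-cong λ b → ≟-suc b a)) (#-singleton a)

remove : ∀ {m} → (Fin m → Bool) → Fin m → Fin m → Bool
remove F a b = F b ∧ not ⌊ b Fin.≟ a ⌋

module _ {n m : ℕ} (D : Digraph n m) where

  inDegree-reverse : ∀ R X → inDegree (reverseArcs D R) X ≡
    # (λ b → not (if R b then X (head D b) else X (tail D b)) ∧ (if R b then X (tail D b) else X (head D b)))
  inDegree-reverse R X = #-cong λ b →
    cong₂ (λ t h → not t ∧ h) (if-float X (R b)) (if-float X (R b))

  -- Carries the `k`-arc-connected target through the induction in `flips`. The two digraphs agree
  -- arc by arc; comparing in-degrees avoids function extensionality.
  reverse-remove : ∀ {F : Fin m → Bool} {a} → F a ≡ true → ∀ X →
    inDegree (reverseArcs D F) X ≡ inDegree (reverseArcs (reverseArc D a) (remove F a)) X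
  reverse-remove {F} {a} Fa X = #-cong λ b →
    cong₂ (λ t h → not (X t) ∧ X h) (swap b (head D b) (tail D b)) (swap b (tail D b) (head D b))
    where
    swap : ∀ b (x y : Fin n) → (if F b then x else y) ≡
      (if remove F a b then (if ⌊ b Fin.≟ a ⌋ then y else x) else (if ⌊ b Fin.≟ a ⌋ then x else y))
    swap b x y with b Fin.≟ a
    ... | yes refl rewrite Fa = refl
    ... | no _ with F b
    ... | true  = refl
    ... | false = refl

  -- Only `a` itself can stop entering `X`. The correction term is 1 if `a` enters `X` and 0
  -- otherwise, and `stuck` uses both values.
  reverse-drop : ∀ a X → inDegree D X ≤
    inDegree (reverseArc D a) X + # (λ b → ⌊ b Fin.≟ a ⌋ ∧ (not (X (tail D b)) ∧ X (head D b)))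
  reverse-drop a X rewrite inDegree-reverse (λ b → ⌊ b Fin.≟ a ⌋) X = count-≤ {m = m}
    (λ b → ⌊ b Fin.≟ a ⌋ ∷ X (tail D b) ∷ X (head D b) ∷ []) (λ _ → true)
    ((λ { (e ∷ t ∷ h ∷ []) → not t ∧ h }) ∷ [])
    ((λ { (e ∷ t ∷ h ∷ []) → not (if e then h else t) ∧ (if e then t else h) })
      ∷ (λ { (e ∷ t ∷ h ∷ []) → e ∧ (not t ∧ h) }) ∷ [])
    refl (λ _ → refl)

  -- `gain` restates that in-degrees after reversing `F` are at least `k`. For `covered`, reversing
  -- `a` brings some `X` below `ℓ`; since at most one entering arc is lost, `X` was tight, and `a`
  -- must have entered it.
  stuck : ∀ {F k ℓ} (ℓ<k : ℓ < k) (2ℓ≤1+k : ℓ + ℓ ≤ suc k) →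
    reverseArcs D F IsArcConnected k → arcConn D ≡ just ℓ →
    (∀ a → F a ≡ true → ¬ (just ℓ ≤∞ arcConn (reverseArc D a))) → Stuck F k ℓ ℓ<k 2ℓ≤1+k D
  stuck {F} {k} {ℓ} ℓ<k 2ℓ≤1+k target eq worse = record
    { connected = conn
    ; gain = λ {X} proper → ≤-trans (+-monoˡ-≤ _ (arcConn-lower (reverseArcs D F) target proper)) (balance X)
    ; covered = cover
    }
    where
    conn : ∀ {X} → Proper X → ℓ ≤ inDegree D X
    conn = arcConn-lower D (subst (just ℓ ≤∞_) (sym eq) ≤-refl)
    balance : ∀ X → inDegree (reverseArcs D F) X + # (λ a → F a ∧ (not (X (tail D a)) ∧ X (head D a)))
      ≤ inDegree D X + # (λ a → F a ∧ (not (X (head D a)) ∧ X (tail D a)))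
    balance X rewrite inDegree-reverse F X = count-≤ {m = m}
      (λ a → F a ∷ X (tail D a) ∷ X (head D a) ∷ []) (λ _ → true)
      ((λ { (f ∷ t ∷ h ∷ []) → not (if f then h else t) ∧ (if f then t else h) })
        ∷ (λ { (f ∷ t ∷ h ∷ []) → f ∧ (not t ∧ h) }) ∷ [])
      ((λ { (f ∷ t ∷ h ∷ []) → not t ∧ h })
        ∷ (λ { (f ∷ t ∷ h ∷ []) → f ∧ (not h ∧ t) }) ∷ [])
      refl (λ _ → refl)
    dropped : ∀ a → ¬ (just ℓ ≤∞ arcConn (reverseArc D a)) →
      ∃[ X ] Proper X × inDegree (reverseArc D a) X < ℓ
    dropped a ¬le with arcConn (reverseArc D a) in eq′
    ... | nothing = ⊥-elim (¬le _)
    ... | just c with arcConn-attained (reverseArc D a) eq′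
    ... | X , proper , refl = X , proper , ≰⇒> ¬le
    cover : ∀ a → F a ≡ true →
      ∃[ X ] Tight F k ℓ ℓ<k 2ℓ≤1+k D X × X (tail D a) ≡ false × X (head D a) ≡ true
    cover a Fa with dropped a (worse a Fa)
    ... | X , proper , less = X , (proper , low) , not-injective (∧-trueˡ enters) , ∧-trueʳ {not (X (tail D a))} enters
      where
      e : Fin m → Bool
      e b = ⌊ b Fin.≟ a ⌋
      low : inDegree D X ≤ ℓ
      low = ≤-trans (reverse-drop a X) (≤-trans (+-monoʳ-≤ _ (≤-trans
        (count-≤ {m = m} (λ b → e b ∷ (not (X (tail D b)) ∧ X (head D b)) ∷ []) (λ _ → true)
          ((λ { (e ∷ c ∷ []) → e ∧ c }) ∷ []) ((λ { (e ∷ c ∷ []) → e }) ∷ []) refl (λ _ → refl))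
        (#-singleton a))) (subst (_≤ ℓ) (+-comm 1 _) less))
      enters : not (X (tail D a)) ∧ X (head D a) ≡ true
      enters with not (X (tail D a)) ∧ X (head D a) in out
      ... | true  = refl
      ... | false = ⊥-elim (<⇒≱ less (begin
          ℓ                                  ≤⟨ conn proper ⟩
          inDegree D X                       ≤⟨ reverse-drop a X ⟩
          inDegree (reverseArc D a) X + # (λ b → e b ∧ (not (X (tail D b)) ∧ X (head D b)))
            ≤⟨ +-monoʳ-≤ _ (count-≤ {m = m} (λ b → (e b ∧ (not (X (tail D b)) ∧ X (head D b))) ∷ [])
                 (λ { (c ∷ []) → not c }) ((λ { (c ∷ []) → c }) ∷ []) [] refl none) ⟩
          inDegree (reverseArc D a) X + 0    ≡⟨ +-identityʳ _ ⟩
          inDegree (reverseArc D a) X ∎))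
        where
        open ≤-Reasoning
        none : ∀ b → not (e b ∧ (not (X (tail D b)) ∧ X (head D b))) ≡ true
        none b with b Fin.≟ a
        ... | yes refl = cong not out
        ... | no _     = refl

-- The sequence of reversals

∷-monotone : ∀ {n m} {D D′ : Digraph n m} as → arcConn D ≤∞ arcConn D′ →
  ArcConnMonotone (flipSeq D′ as) → ArcConnMonotone (D ∷ flipSeq D′ as)
∷-monotone []       le mono = le ∷ mono
∷-monotone (_ ∷ as) le mono = le ∷ mono

module _ {n m k : ℕ} (2≤k : 2 ≤ k) where

  module _ {ℓ} (ℓ<target : ℓ < (k + 3) / 2) where

    -- Below the target value, ℓ + 1 ≤ ⌊(k + 3) / 2⌋, hence 2ℓ + 2 ≤ k + 3.
    double : ℓ + ℓ ≤ suc k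
    double = +-cancelʳ-≤ 2 _ _ (begin
      ℓ + ℓ + 2         ≡⟨ shuffle ℓ ⟩
      suc ℓ * 2         ≤⟨ *-monoˡ-≤ 2 ℓ<target ⟩
      (k + 3) / 2 * 2   ≤⟨ m/n*n≤m (k + 3) 2 ⟩
      k + 3             ≡⟨ +-suc k 2 ⟩
      suc k + 2 ∎)
      where
      open ≤-Reasoning
      shuffle : ∀ ℓ → ℓ + ℓ + 2 ≡ suc ℓ * 2
      shuffle = solve-∀

    -- Here `2≤k` enters: k ≤ ℓ would give 2k ≤ 2ℓ ≤ k + 1.
    below : ℓ < k
    below = ≰⇒> λ k≤ℓ → 1+n≰n (≤-trans (+-monoˡ-≤ k 2≤k) (≤-trans (+-mono-≤ k≤ℓ k≤ℓ) double))

  -- Induction on the size of `F`: a reversed arc is removed from `F`, which leaves the target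
  -- unchanged. Below the bound, `not-stuck` guarantees an arc whose reversal does not lower λ.
  flips : ∀ fuel (D : Digraph n m) F → # F < fuel → reverseArcs D F IsArcConnected k →
    Σ (List (Fin m)) λ as → All (λ a → F a ≡ true) as × ArcConnMonotone (flipSeq D as)
      × just ((k + 3) / 2) ≤∞ arcConn (lastDigraph D as)
  flips (suc fuel) D F #F≤fuel target with arcConn D in eq
  -- λ is ∞ when no nonempty proper vertex set exists, so nothing has to be reversed.
  ... | nothing = [] , [] , [ D ] , subst (just ((k + 3) / 2) ≤∞_) (sym eq) _
  ... | just ℓ with (k + 3) / 2 ≤? ℓ
  ... | yes le = [] , [] , [ D ] , subst (just ((k + 3) / 2) ≤∞_) (sym eq) le
  ... | no ¬le with any? (λ a → (F a Bool.≟ true) ×-dec (just ℓ ≤∞? arcConn (reverseArc D a)))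
  ... | no none with arcConn-attained D eq
  ... | X , proper , deg = ⊥-elim (not-stuck F k ℓ (below (≰⇒> ¬le)) (double (≰⇒> ¬le))
      (stuck D (below (≰⇒> ¬le)) (double (≰⇒> ¬le)) target eq (λ a Fa le → none (a , Fa , le)))
      (proper , ≤-reflexive deg))
  flips (suc fuel) D F #F≤fuel target | just ℓ | no ¬le | yes (a , Fa , le)
    with flips fuel (reverseArc D a) (remove F a)
      (<-≤-trans (#-⊂ {X = remove F a} {Y = F} {u = a} ∧-trueˡ removed Fa) (≤-pred #F≤fuel))
      (arcConn-greatest (reverseArcs (reverseArc D a) (remove F a)) λ {X} proper →
        subst (k ≤_) (reverse-remove D Fa X) (arcConn-lower (reverseArcs D F) target proper))
    where
    removed : remove F a a ≡ false
    removed with a Fin.≟ a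
    ... | yes _  = cong (_∧ false) Fa
    ... | no a≢a = ⊥-elim (a≢a refl)
  ... | as , as⊆F , mono , final = a ∷ as , Fa ∷ All.map ∧-trueˡ as⊆F
    , ∷-monotone as (subst (_≤∞ arcConn (reverseArc D a)) (sym eq) le) mono , final

theorem7 : ∀ {n m : ℕ} (D₀ : Digraph n m) (k : ℕ) → 2 ≤ k →
    (F : Fin m → Bool) → reverseArcs D₀ F IsArcConnected k →
    Σ (List (Fin m)) λ as →
    All (λ a → F a ≡ true) as
    × ArcConnMonotone (flipSeq D₀ as)
    × just ((k + 3) / 2) ≤∞ arcConn (lastDigraph D₀ as)
theorem7 D₀ k 2≤k F target = flips 2≤k (suc (# F)) D₀ F ≤-refl target
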